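{- Let $T$ be a finite tree with at least two vertices. Then $\gamma_{\mathrm{m}}^{\infty}(T)=\theta(T)$ if and only if the reduction R2 can be applied repeatedly (zero or more times) to $T$ to obtain a star $K_{1,r}$ with $r\in\{1,2\}$.
   Context: All graphs are finite, simple and undirected. A dominating set of $G=(V,E)$ is a set $D\subseteq V$ such that every vertex of $V-D$ is adjacent to a vertex of $D$. m-eternal domination ("all guards move"): a defender chooses a set $D_1\subseteq V$ and places one guard on each vertex of $D_1$. Then, for $i=1,2,\ldots$ in turn, an attacker (knowing the current position) chooses a vertex $r_i\in V-D_i$, and the defender responds with a set $D_{i+1}$ with $|D_{i+1}|=|D_i|$ and $r_i\in D_{i+1}$, obtained from $D_i$ by letting each guard either stay in place or move to an adjacent vertex (i.e. there is a bijection $f:D_i\to D_{i+1}$ with $f(v)=v$ or $f(v)$ adjacent to $v$ for each $v\in D_i$). Every $D_i$ must be a dominating set. $D_1$ is an m-eternal dominating set if the defender, starting from $D_1$, can respond in this way forever to every infinite sequence of attacks. $\gamma_{\mathrm{m}}^{\infty}(G)$ is the minimum size of an m-eternal dominating set of $G$. The clique covering number $\theta(G)$ is the minimum number $k$ of sets in a partition $V=V_1\cup\cdots\cup V_k$ such that each induced subgraph $G[V_i]$ is complete. In a tree, a leaf is a vertex of degree one and a stem is a vertex adjacent to a leaf. Reduction R2: let $x$ be a stem of degree two in $T$ such that $x$ is adjacent to exactly one leaf, $y$; delete both $x$ and $y$ (the result is again a tree). -}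

module Defs where

open import Level using (0ℓ) renaming (suc to lsuc)
open import Data.Fin.Base using (Fin; zero; suc; punchIn; punchOut)
open import Data.Fin.Subset using (Subset; _∈_; _∉_; ∣_∣)
open import Data.List.Base using (List; []; _∷_; _∷ʳ_; length)
open import Data.List.Relation.Unary.Linked using (Linked)
open import Data.List.Relation.Unary.Unique.Propositional using (Unique)
open import Data.Nat.Base using (ℕ; suc; _+_; _≤_)
open import Data.Product.Base using (∃; _×_; _,_; proj₁)
open import Data.Sum.Base using (_⊎_)
open import Data.Empty using (⊥)
open import Data.Unit.Base using (⊤; tt)
open import Data.Vec.Base using (tabulate)
open import Function.Bundles using (_⇔_; _⤖_; module Bijection)
open import Function.Definitions using (Surjective)
open import Relation.Binary.Core using (Rel)
open import Relation.Binary.Definitions using (Symmetric; Irreflexive; Decidable)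
open import Relation.Binary.Construct.Closure.ReflexiveTransitive using (Star)
open import Relation.Binary.PropositionalEquality using (_≡_; _≢_; refl; cong)
open import Relation.Nullary using (¬_; yes; no; does)

record Graph (n : ℕ) : Set₁ where
  field
    Adj    : Rel (Fin n) 0ℓ
    adj?   : Decidable Adj
    sym    : Symmetric Adj
    irrefl : Irreflexive _≡_ Adj

  adj⇒≢ : ∀ {u v} → Adj u v → u ≢ v
  adj⇒≢ uv u≡v = irrefl u≡v uv

  neighbours : Fin n → Subset n
  neighbours v = tabulate (λ w → does (adj? v w))

  degree : Fin n → ℕ
  degree v = ∣ neighbours v ∣

open Graph public using (Adj; adj?; adj⇒≢; neighbours; degree)

record _≅_ {m n} (G : Graph m) (H : Graph n) : Set where
  field
    vertices  : Fin m ⤖ Fin n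
    adjacency : ∀ u v →
      Adj G u v ⇔ Adj H (Bijection.to vertices u) (Bijection.to vertices v)

infixl 6 _─_

-- Vertex deletion: punchIn v enumerates the vertices other than v.
_─_ : ∀ {n} → Graph (suc n) → Fin (suc n) → Graph n
G ─ v = record
  { Adj    = λ i j → Adj G (punchIn v i) (punchIn v j)
  ; adj?   = λ i j → adj? G (punchIn v i) (punchIn v j)
  ; sym    = Graph.sym G
  ; irrefl = λ i≡j → Graph.irrefl G (cong (punchIn v) i≡j)
  }

module _ (r : ℕ) where

  StarAdj : Rel (Fin (suc r)) 0ℓ
  StarAdj zero    zero    = ⊥
  StarAdj zero    (suc _) = ⊤
  StarAdj (suc _) zero    = ⊤
  StarAdj (suc _) (suc _) = ⊥

  starAdj? : Decidable StarAdj
  starAdj? zero    zero    = no λ ()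
  starAdj? zero    (suc _) = yes tt
  starAdj? (suc _) zero    = yes tt
  starAdj? (suc _) (suc _) = no λ ()

  starAdj-sym : Symmetric StarAdj
  starAdj-sym {zero}  {suc _} _ = tt
  starAdj-sym {suc _} {zero}  _ = tt

  starAdj-irrefl : Irreflexive _≡_ StarAdj
  starAdj-irrefl {zero}  refl ()
  starAdj-irrefl {suc _} refl ()

K₁,_ : ∀ r → Graph (suc r)
K₁, r = record
  { Adj    = StarAdj r
  ; adj?   = starAdj? r
  ; sym    = λ {u} {v} → starAdj-sym r {u} {v}
  ; irrefl = starAdj-irrefl r
  }

Connected : ∀ {n} → Graph n → Set
Connected G = ∀ u v → Star (Adj G) u v

-- The closed walk v, vs, v is a cycle: v ∷ vs has at least three vertices,
-- all distinct.
record Cycle {n} (G : Graph n) (v : Fin n) (vs : List (Fin n)) : Set where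
  field
    distinct : Unique (v ∷ vs)
    closed   : Linked (Adj G) (v ∷ (vs ∷ʳ v))
    long     : 2 ≤ length vs

Acyclic : ∀ {n} → Graph n → Set
Acyclic G = ∀ v vs → ¬ Cycle G v vs

record IsTree {n} (G : Graph n) : Set where
  field
    connected : Connected G
    acyclic   : Acyclic G

IsMinimum : (ℕ → Set) → ℕ → Set
IsMinimum P k = P k × (∀ j → P j → k ≤ j)

module _ {n} (G : Graph n) where

  Dominating : Subset n → Set
  Dominating D = ∀ v → v ∉ D → ∃ λ u → u ∈ D × Adj G v u

  record GuardMove (D D′ : Subset n) : Set where
    field
      move  : ∃ (_∈ D) ⤖ ∃ (_∈ D′)
      legal : ∀ g → let v = proj₁ g ; w = proj₁ (Bijection.to move g) in
              w ≡ v ⊎ Adj G v w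

  record Response (D : Subset n) (r : Fin n) (D′ : Subset n) : Set where
    field
      sameSize  : ∣ D′ ∣ ≡ ∣ D ∣
      defended  : r ∈ D′
      guardMove : GuardMove D D′

  -- A history lists the attacks made so far, most recent first, and a defence
  -- strategy assigns to each history the position reached after it.
  Strategy : Set
  Strategy = List (Fin n) → Subset n

  data Playable (σ : Strategy) : List (Fin n) → Set where
    []  : Playable σ []
    _∷_ : ∀ {r h} → r ∉ σ h → Playable σ h → Playable σ (r ∷ h)

  -- An infinite sequence of attacks is defended when all its finite prefixes
  -- are, so it suffices to quantify over finite histories.
  record Defends (D₁ : Subset n) (σ : Strategy) : Set where
    field
      start      : σ [] ≡ D₁
      dominating : ∀ {h} → Playable σ h → Dominating (σ h)
      response   : ∀ {h} r → Playable σ h → r ∉ σ h →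
                   Response (σ h) r (σ (r ∷ h))

  MEternalDominating : Subset n → Set
  MEternalDominating D₁ = ∃ λ σ → Defends D₁ σ

  IsMEternalDominationNumber : ℕ → Set
  IsMEternalDominationNumber =
    IsMinimum λ k → ∃ λ D → MEternalDominating D × ∣ D ∣ ≡ k

  -- Surjectivity says that the parts of the partition are nonempty.
  record CliquePartition (k : ℕ) : Set where
    field
      part     : Fin n → Fin k
      nonempty : Surjective _≡_ _≡_ part
      clique   : ∀ u v → part u ≡ part v → u ≢ v → Adj G u v

  IsCliqueCoveringNumber : ℕ → Set
  IsCliqueCoveringNumber = IsMinimum CliquePartition

-- The minimum of a set of naturals is unique, but computing it would need a
-- decision procedure, so the equality of two minima is the existence of a
-- common value.
γₘ^∞≡θ : ∀ {n} → Graph n → Set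
γₘ^∞≡θ G = ∃ λ k → IsMEternalDominationNumber G k × IsCliqueCoveringNumber G k

module _ {n} (G : Graph n) where

  Leaf : Fin n → Set
  Leaf v = degree G v ≡ 1

  Stem : Fin n → Set
  Stem v = ∃ λ w → Adj G v w × Leaf w

  record R2Pair (x y : Fin n) : Set where
    field
      stem     : Stem x
      degree-x : degree G x ≡ 2
      adjacent : Adj G x y
      leaf     : Leaf y
      onlyLeaf : ∀ z → Adj G x z → Leaf z → z ≡ y

data R2 : Rel (∃ Graph) (lsuc 0ℓ) where
  delete : ∀ {n} (G : Graph (2 + n)) (x y : Fin (2 + n)) (p : R2Pair G x y) →
           R2 (2 + n , G)
              (n , G ─ x ─ punchOut (adj⇒≢ G (R2Pair.adjacent p)))

-- Graphs are not identified up to isomorphism, so the final graph is only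
-- required to be isomorphic to H.
record R2ReducesTo {m n} (G : Graph m) (H : Graph n) : Set₁ where
  field
    {order} : ℕ
    final   : Graph order
    steps   : Star R2 (m , G) (order , final)
    iso     : final ≅ H

{-# OPTIONS --safe #-}

-- Both conditions say that the clique covering number θ of the tree is at most
-- ⌈ n /2⌉, that is, that some matching misses at most one vertex. Near the end
-- of a longest path, a tree has two leaves at a common vertex or a pendant
-- edge; deleting these two vertices costs one guard, so ⌈ n /2⌉ guards always
-- suffice, and equality of the two parameters forces θ ≤ ⌈ n /2⌉. When all
-- vertices but s are matched, the end of a longest path starting in s admits
-- R2 or the tree is K₁,₁ or K₁,₂. Conversely, a guard per clique shows that at
-- most θ guards are needed, and R2 lowers both parameters by one: retracting
-- the deleted pair onto the neighbour of x turns a defence of the tree into a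
-- defence of the smaller tree in which one guard is superfluous.

module Submission where

open import Defs
open import Data.Bool.Base using (Bool; true; false; if_then_else_)
open import Data.Empty using (⊥; ⊥-elim)
open import Data.Fin.Base as Fin using (Fin; zero; suc; punchIn; punchOut; combine)
open import Data.Fin.Permutation as Perm
  using (Permutation; _⟨$⟩ʳ_; _⟨$⟩ˡ_; _∘ₚ_; lift₀; transpose; remove; punchIn-permute; ↔⇒≡)
open import Data.Fin.Properties
  using (_≟_; _<?_; any?; <-cmp; <⇒≢; <-trans; suc-injective; punchIn-injective; punchInᵢ≢i;
         punchIn-punchOut; injective⇒≤; combine-injective)
open import Data.Fin.Subset using (Subset; inside; outside; _∈_; ∣_∣)
open import Data.Fin.Subset.Properties using (_∈?_)
open import Data.List.Base using (List; []; _∷_; _∷ʳ_; length; lookup; map)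
open import Data.List.Membership.DecPropositional using () renaming (_∈?_ to member?)
open import Data.List.Membership.Propositional using () renaming (_∈_ to _∈ˡ_; _∉_ to _∉ˡ_)
open import Data.List.Membership.Propositional.Properties using (∈-lookup)
open import Data.List.Properties using (map-++; length-map)
open import Data.List.Relation.Unary.All as All using (All; []; _∷_)
open import Data.List.Relation.Unary.All.Properties using (¬Any⇒All¬)
open import Data.List.Relation.Unary.AllPairs using ([]; _∷_)
open import Data.List.Relation.Unary.Any using (here; there)
open import Data.List.Relation.Unary.Linked as Linked using (Linked; []; [-]; _∷_)
import Data.List.Relation.Unary.Linked.Properties as Linked
open import Data.List.Relation.Unary.Unique.Propositional using (Unique)
import Data.List.Relation.Unary.Unique.Propositional.Properties as Unique
open import Data.Nat.Base using (ℕ; zero; suc; _+_; _*_; _≤_; _<_; z≤n; s≤s; ⌈_/2⌉)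
open import Data.Nat.Properties using (+-suc; <⇒≱; m<m+n; ≤-trans; *-monoˡ-≤)
open import Data.Product.Base using (Σ; ∃; _×_; _,_; proj₁; proj₂)
open import Data.Sum.Base using (_⊎_; inj₁; inj₂; [_,_]′)
open import Data.Unit.Base using (⊤; tt)
open import Data.Vec.Base using (_∷_; []; here; there; tabulate)
open import Data.Vec.Properties using (lookup⇒[]=; []=⇒lookup; lookup∘tabulate)
open import Function.Base using (id; _∘_)
open import Function.Bundles
  using (_⇔_; _↔_; mk⇔; mk↔ₛ′; module Inverse; module Bijection; module Equivalence)
open import Function.Definitions using (Injective)
open import Function.Properties.Bijection using (⤖⇒↔)
open import Function.Properties.Inverse using (↔-sym; ↔-trans; ↔⇒⤖)
open import Relation.Binary.Construct.Closure.ReflexiveTransitive using (Star; ε; _◅_)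
open import Relation.Binary.Definitions using (tri<; tri≈; tri>)
open import Relation.Binary.PropositionalEquality
  using (_≡_; _≢_; refl; sym; trans; cong; subst; subst₂)
open import Relation.Nullary using (¬_; Dec; yes; no; does; contradiction)
open import Relation.Nullary.Decidable using (dec-true; decidable-stable; ¬?; _×-dec_)

-- Subsets and their enumerations

∈-irrelevant : ∀ {n} {S : Subset n} {v} (p q : v ∈ S) → p ≡ q
∈-irrelevant here      here      = refl
∈-irrelevant (there p) (there q) = cong there (∈-irrelevant p q)

∈-pair-≡ : ∀ {n} {S : Subset n} {p q : ∃ (_∈ S)} → proj₁ p ≡ proj₁ q → p ≡ q
∈-pair-≡ {p = v , _} refl = cong (v ,_) (∈-irrelevant _ _)

does-true⁻ : ∀ {P : Set} (d : Dec P) → does d ≡ true → P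
does-true⁻ (yes p) _ = p

module _ {n} {P : Fin n → Set} (P? : ∀ v → Dec (P v)) where

  comprehension : Subset n
  comprehension = tabulate (λ v → does (P? v))

  ∈-comprehension⁺ : ∀ {v} → P v → v ∈ comprehension
  ∈-comprehension⁺ {v} p =
    lookup⇒[]= v comprehension
      (trans (lookup∘tabulate (λ w → does (P? w)) v) (dec-true (P? v) p))

  ∈-comprehension⁻ : ∀ {v} → v ∈ comprehension → P v
  ∈-comprehension⁻ {v} v∈ = does-true⁻ (P? v)
    (trans (sym (lookup∘tabulate (λ w → does (P? w)) v)) ([]=⇒lookup v∈))

-- A bijection rather than an equation of sizes: it also labels the guards on `S`, so that moves
-- between positions compose with it.
Enumeration : ∀ {n} → Subset n → ℕ → Set
Enumeration S k = Fin k ↔ ∃ (_∈ S)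

enumerate : ∀ {n} (S : Subset n) → Enumeration S ∣ S ∣
enumerate [] = mk↔ₛ′ (λ ()) (λ ()) (λ ()) (λ ())
enumerate (outside ∷ S) = ↔-trans (enumerate S)
  (mk↔ₛ′ (λ (v , p) → suc v , there p) (λ { (suc v , there p) → v , p })
         (λ { (suc v , there p) → refl }) (λ _ → refl))
enumerate (inside ∷ S) = mk↔ₛ′ to from to∘from from∘to
  where
  module E = Inverse (enumerate S)

  to : Fin (suc ∣ S ∣) → ∃ (_∈ (inside ∷ S))
  to zero    = zero , here
  to (suc i) = suc (proj₁ (E.to i)) , there (proj₂ (E.to i))

  from : ∃ (_∈ (inside ∷ S)) → Fin (suc ∣ S ∣)
  from (zero  , _)       = zero
  from (suc v , there p) = suc (E.from (v , p))

  to∘from : ∀ g → to (from g) ≡ g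
  to∘from (zero  , here)    = refl
  to∘from (suc v , there p) = ∈-pair-≡ (cong (suc ∘ proj₁) (E.inverseˡ {v , p} refl))

  from∘to : ∀ i → from (to i) ≡ i
  from∘to zero    = refl
  from∘to (suc i) = cong suc (E.inverseʳ refl)

enumeration : ∀ {n k} {S : Subset n} (c : Fin k → Fin n) → Injective _≡_ _≡_ c →
              (∀ i → c i ∈ S) → (∀ {v} → v ∈ S → ∃ λ i → c i ≡ v) → Enumeration S k
enumeration c c-injective sound complete = mk↔ₛ′
  (λ i → c i , sound i)
  (λ (_ , p) → proj₁ (complete p))
  (λ (_ , p) → ∈-pair-≡ (proj₂ (complete p)))
  (λ i → c-injective (proj₂ (complete (sound i))))

enumeration-size : ∀ {n k} {S : Subset n} → Enumeration S k → ∣ S ∣ ≡ k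
enumeration-size {S = S} e = ↔⇒≡ (↔-trans (enumerate S) (↔-sym e))

Fin1-irrelevant : (i j : Fin 1) → i ≡ j
Fin1-irrelevant zero zero = refl

pair : ∀ {A : Set} → A → A → Fin 2 → A
pair a b zero    = a
pair a b (suc _) = b

pair-injective : ∀ {A : Set} {a b : A} → a ≢ b → Injective _≡_ _≡_ (pair a b)
pair-injective a≢b {zero}     {zero}     _  = refl
pair-injective a≢b {zero}     {suc zero} eq = contradiction eq a≢b
pair-injective a≢b {suc zero} {zero}     eq = contradiction (sym eq) a≢b
pair-injective a≢b {suc zero} {suc zero} _  = refl

-- Vertices of degree one and two

module _ {n} (G : Graph n) where

  ∈-neighbours⁺ : ∀ {v w} → Adj G v w → w ∈ neighbours G v
  ∈-neighbours⁺ {v} = ∈-comprehension⁺ (adj? G v)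

  ∈-neighbours⁻ : ∀ {v w} → w ∈ neighbours G v → Adj G v w
  ∈-neighbours⁻ {v} = ∈-comprehension⁻ (adj? G v)

  degree-enumeration : ∀ {v d} → degree G v ≡ d → Enumeration (neighbours G v) d
  degree-enumeration {v} eq = subst (Enumeration (neighbours G v)) eq (enumerate _)

  degree≡1⁺ : ∀ {v x} → Adj G v x → (∀ w → Adj G v w → w ≡ x) → degree G v ≡ 1
  degree≡1⁺ {v} {x} vx only = enumeration-size (enumeration (λ _ → x)
    (λ _ → Fin1-irrelevant _ _) (λ _ → ∈-neighbours⁺ vx)
    (λ p → zero , sym (only _ (∈-neighbours⁻ p))))

  degree≡1⁻ : ∀ {v x w} → degree G v ≡ 1 → Adj G v x → Adj G v w → w ≡ x
  degree≡1⁻ {v} {x} {w} eq vx vw = cong proj₁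
    (trans (sym (E.inverseˡ refl))
      (trans (cong E.to (Fin1-irrelevant (E.from (w , ∈-neighbours⁺ vw)) (E.from (x , ∈-neighbours⁺ vx))))
             (E.inverseˡ refl)))
    where
    module E = Inverse (degree-enumeration eq)

  degree≡2⁺ : ∀ {v x y} → x ≢ y → Adj G v x → Adj G v y →
              (∀ w → Adj G v w → w ≡ x ⊎ w ≡ y) → degree G v ≡ 2
  degree≡2⁺ {v} {x} {y} x≢y vx vy only =
    enumeration-size (enumeration (pair x y) (pair-injective x≢y) sound complete)
    where
    sound : ∀ i → pair x y i ∈ neighbours G v
    sound zero    = ∈-neighbours⁺ vx
    sound (suc _) = ∈-neighbours⁺ vy

    complete : ∀ {w} → w ∈ neighbours G v → ∃ λ i → pair x y i ≡ w
    complete p with only _ (∈-neighbours⁻ p)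
    ... | inj₁ refl = zero , refl
    ... | inj₂ refl = suc zero , refl

  degree≡2⁻ : ∀ {v y} → degree G v ≡ 2 → Adj G v y →
              ∃ λ u → u ≢ y × Adj G v u × (∀ w → Adj G v w → w ≡ y ⊎ w ≡ u)
  degree≡2⁻ {v} {y} eq vy = other (E.from (y , ∈-neighbours⁺ vy)) (E.inverseˡ refl)
    where
    module E = Inverse (degree-enumeration eq)

    listed : ∀ {w} → Adj G v w → proj₁ (E.to zero) ≡ w ⊎ proj₁ (E.to (suc zero)) ≡ w
    listed {w} vw with E.from (w , ∈-neighbours⁺ vw) in eq′
    ... | zero     = inj₁ (cong proj₁ (E.inverseˡ (sym eq′)))
    ... | suc zero = inj₂ (cong proj₁ (E.inverseˡ (sym eq′)))

    distinct : proj₁ (E.to zero) ≢ proj₁ (E.to (suc zero))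
    distinct eq′ with () ←
      trans (sym (E.inverseʳ {x = zero} refl)) (trans (cong E.from (∈-pair-≡ eq′)) (E.inverseʳ refl))

    other : (i : Fin 2) → E.to i ≡ (y , ∈-neighbours⁺ vy) →
            ∃ λ u → u ≢ y × Adj G v u × (∀ w → Adj G v w → w ≡ y ⊎ w ≡ u)
    other zero at =
      proj₁ (E.to (suc zero)) ,
      (λ eq′ → distinct (trans (cong proj₁ at) (sym eq′))) ,
      ∈-neighbours⁻ (proj₂ (E.to (suc zero))) ,
      λ w vw → [ (λ eq′ → inj₁ (trans (sym eq′) (cong proj₁ at)))
               , (λ eq′ → inj₂ (sym eq′)) ]′ (listed vw)
    other (suc zero) at =
      proj₁ (E.to zero) ,
      (λ eq′ → distinct (trans eq′ (sym (cong proj₁ at)))) ,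
      ∈-neighbours⁻ (proj₂ (E.to zero)) ,
      λ w vw → [ (λ eq′ → inj₂ (sym eq′))
               , (λ eq′ → inj₁ (trans (sym eq′) (cong proj₁ at))) ]′ (listed vw)

-- Deleting two vertices

-- Describes the remainder through an embedding, which spares later proofs any computation with
-- `punchIn` and `punchOut`.
record Removal {n m} (G : Graph n) (a b : Fin n) (G′ : Graph m) : Set where
  field
    embed           : Fin m → Fin n
    embed-injective : Injective _≡_ _≡_ embed
    embed≢a         : ∀ i → embed i ≢ a
    embed≢b         : ∀ i → embed i ≢ b
    cover           : ∀ v → v ≡ a ⊎ v ≡ b ⊎ ∃ λ i → embed i ≡ v
    adj⁺            : ∀ {i j} → Adj G′ i j → Adj G (embed i) (embed j)
    adj⁻            : ∀ {i j} → Adj G (embed i) (embed j) → Adj G′ i j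

  embed-outside : ∀ {i v} → embed i ≡ v → v ≡ a ⊎ v ≡ b → ⊥
  embed-outside {i} eq (inj₁ v≡a) = embed≢a i (trans eq v≡a)
  embed-outside {i} eq (inj₂ v≡b) = embed≢b i (trans eq v≡b)

  inside-remainder : ∀ {v} → v ≢ a → v ≢ b → ∃ λ i → embed i ≡ v
  inside-remainder {v} v≢a v≢b with cover v
  ... | inj₁ v≡a        = contradiction v≡a v≢a
  ... | inj₂ (inj₁ v≡b) = contradiction v≡b v≢b
  ... | inj₂ (inj₂ v∈)  = v∈

removal : ∀ {n} (G : Graph (2 + n)) (a b : Fin (2 + n)) (a≢b : a ≢ b) →
          Removal G a b (G ─ a ─ punchOut a≢b)
removal G a b a≢b = record
  { embed           = embed
  ; embed-injective = λ eq → punchIn-injective (punchOut a≢b) _ _ (punchIn-injective a _ _ eq)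
  ; embed≢a         = λ _ → punchInᵢ≢i a _
  ; embed≢b         = λ i eq → punchInᵢ≢i (punchOut a≢b) i
                        (punchIn-injective a _ _ (trans eq (sym (punchIn-punchOut a≢b))))
  ; cover           = cover
  ; adj⁺            = id
  ; adj⁻            = id
  }
  where
  embed : Fin _ → Fin _
  embed i = punchIn a (punchIn (punchOut a≢b) i)

  cover : ∀ v → v ≡ a ⊎ v ≡ b ⊎ ∃ λ i → embed i ≡ v
  cover v with a ≟ v
  ... | yes a≡v = inj₁ (sym a≡v)
  ... | no  a≢v with punchOut a≢b ≟ punchOut a≢v
  ...   | yes eq = inj₂ (inj₁ (trans (sym (punchIn-punchOut a≢v))
                     (trans (cong (punchIn a) (sym eq)) (punchIn-punchOut a≢b))))
  ...   | no neq = inj₂ (inj₂ (punchOut neq ,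
                     trans (cong (punchIn a) (punchIn-punchOut neq)) (punchIn-punchOut a≢v)))

acyclic-removal : ∀ {n m} {G : Graph n} {a b} {G′ : Graph m} →
                  Removal G a b G′ → Acyclic G → Acyclic G′
acyclic-removal {G = G} {G′ = G′} R acyclic v vs cycle = acyclic (embed v) (map embed vs) record
  { distinct = Unique.map⁺ embed-injective (Cycle.distinct cycle)
  ; closed   = subst (λ ws → Linked (Adj G) (embed v ∷ ws)) (map-++ embed vs (v ∷ []))
                 (Linked.map⁺ (Linked.map adj⁺ (Cycle.closed cycle)))
  ; long     = subst (2 ≤_) (sym (length-map embed vs)) (Cycle.long cycle)
  }
  where open Removal R

-- Retraction onto the remainder

Legal : ∀ {n} → Graph n → Fin n → Fin n → Set
Legal G u v = v ≡ u ⊎ Adj G u v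

legal-sym : ∀ {n} (G : Graph n) {u v} → Legal G u v → Legal G v u
legal-sym G = [ inj₁ ∘ sym , inj₂ ∘ Graph.sym G ]′

-- The deleted pair is attached to the rest of the graph at one vertex only,
-- so G retracts onto G′ by sending the pair to that vertex.
record Pendant {n m} (G : Graph n) (a b : Fin n) (G′ : Graph m) : Set where
  field
    removed : Removal G a b G′
  open Removal removed public
  field
    anchor : Fin m
    nbr-a  : ∀ v → Adj G a v → v ≡ b ⊎ v ≡ embed anchor
    nbr-b  : ∀ v → Adj G b v → v ≡ a ⊎ v ≡ embed anchor

  retract : Fin n → Fin m
  retract v with cover v
  ... | inj₁ _              = anchor
  ... | inj₂ (inj₁ _)       = anchor
  ... | inj₂ (inj₂ (i , _)) = i

  retract-embed : ∀ i → retract (embed i) ≡ i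
  retract-embed i with cover (embed i)
  ... | inj₁ eq              = contradiction eq (embed≢a i)
  ... | inj₂ (inj₁ eq)       = contradiction eq (embed≢b i)
  ... | inj₂ (inj₂ (_ , eq)) = embed-injective eq

  retract-pair : ∀ {v} → v ≡ a ⊎ v ≡ b → retract v ≡ anchor
  retract-pair {v} v∈ with cover v
  ... | inj₁ _              = refl
  ... | inj₂ (inj₁ _)       = refl
  ... | inj₂ (inj₂ (_ , eq)) = ⊥-elim (embed-outside eq v∈)

  -- From the pair a guard can stay, cross to the other deleted vertex or step to the anchor, and
  -- all three places retract to the anchor.
  retract-near : ∀ {v w} → v ≡ a ⊎ v ≡ b → Legal G v w → retract w ≡ anchor
  retract-near v∈ (inj₁ refl) = retract-pair v∈
  retract-near {w = w} (inj₁ refl) (inj₂ vw) with nbr-a w vw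
  ... | inj₁ w≡b  = retract-pair (inj₂ w≡b)
  ... | inj₂ refl = retract-embed anchor
  retract-near {w = w} (inj₂ refl) (inj₂ vw) with nbr-b w vw
  ... | inj₁ w≡a  = retract-pair (inj₁ w≡a)
  ... | inj₂ refl = retract-embed anchor

  retract-legal : ∀ {v w} → Legal G v w → Legal G′ (retract v) (retract w)
  retract-legal {v} {w} vw = split (cover v) (cover w)
    where
    collapse : ∀ {v w} → v ≡ a ⊎ v ≡ b → Legal G v w → retract w ≡ retract v
    collapse v∈ vw = trans (retract-near v∈ vw) (sym (retract-pair v∈))

    split : v ≡ a ⊎ v ≡ b ⊎ (∃ λ i → embed i ≡ v) → w ≡ a ⊎ w ≡ b ⊎ (∃ λ i → embed i ≡ w) →
            Legal G′ (retract v) (retract w)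
    split (inj₁ v≡a)        _                 = inj₁ (collapse (inj₁ v≡a) vw)
    split (inj₂ (inj₁ v≡b)) _                 = inj₁ (collapse (inj₂ v≡b) vw)
    split (inj₂ (inj₂ _)) (inj₁ w≡a)          = inj₁ (sym (collapse (inj₁ w≡a) (legal-sym G vw)))
    split (inj₂ (inj₂ _)) (inj₂ (inj₁ w≡b))   = inj₁ (sym (collapse (inj₂ w≡b) (legal-sym G vw)))
    split (inj₂ (inj₂ (i , refl))) (inj₂ (inj₂ (j , refl))) rewrite retract-embed i | retract-embed j =
      [ inj₁ ∘ embed-injective , inj₂ ∘ adj⁻ ]′ vw

-- Retracting a walk of `G` yields a walk of `G′` once the steps that become stationary are dropped.
connected-pendant : ∀ {n m} {G : Graph n} {a b} {G′ : Graph m} →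
                    Pendant G a b G′ → Connected G → Connected G′
connected-pendant {G = G} {G′ = G′} P connected i j =
  walk (retract-embed i) (connected (embed i) (embed j))
  where
  open Pendant P
  walk : ∀ {i v} → retract v ≡ i → Star (Adj G) v (embed j) → Star (Adj G′) i j
  walk eq ε with trans (sym eq) (retract-embed j)
  ... | refl = ε
  walk refl (vw ◅ rest) with retract-legal (inj₂ vw)
  ... | inj₁ eq   = walk eq rest
  ... | inj₂ vw′  = vw′ ◅ walk refl rest

tree-pendant : ∀ {n m} {G : Graph n} {a b} {G′ : Graph m} →
               Pendant G a b G′ → IsTree G → IsTree G′
tree-pendant P tree = record
  { connected = connected-pendant P (IsTree.connected tree)
  ; acyclic   = acyclic-removal (Pendant.removed P) (IsTree.acyclic tree)
  }

-- Guards carry labels and several of them may share a vertex; a step may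
-- permute the labels.
Step : ∀ {n} → Graph n → ∀ {k} → (c c′ : Fin k → Fin n) → Set
Step G {k} c c′ = ∃ λ (π : Permutation k k) → ∀ i → Legal G (c i) (c′ (π ⟨$⟩ʳ i))

-- Since `respond` answers an attack at every vertex, occupied or not, each vertex has a guard on it
-- or next to it; domination is thus implied.
record Defence {n} (G : Graph n) (k : ℕ) : Set₁ where
  field
    State   : Set
    start   : State
    guards  : State → Fin k → Fin n
    respond : ∀ s r → ∃ λ s′ → Step G (guards s) (guards s′) × ∃ λ i → guards s′ i ≡ r

-- One guard per vertex, as in the game. Upper bounds are built in this form; lower bounds are
-- proved against every `Defence`, since retraction can put two guards on one vertex.
record InjectiveDefence {n} (G : Graph n) (k : ℕ) : Set₁ where
  field
    defence : Defence G k
  open Defence defence public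
  field
    guards-injective : ∀ s → Injective _≡_ _≡_ (guards s)

-- The lower bound

-- Composing `π` with the transposition of the image of `i` and `i′` can change only the images of
-- `i` and of the label that `π` sends to `i′`.
redirect : ∀ {k} (π : Permutation k k) (i i′ : Fin k) → ∃ λ (π′ : Permutation k k) →
           π′ ⟨$⟩ʳ i ≡ i′ ×
           (∀ j → π′ ⟨$⟩ʳ j ≡ π ⟨$⟩ʳ j ⊎ (j ≡ i × π′ ⟨$⟩ʳ j ≡ i′) ⊎
                  (π ⟨$⟩ʳ j ≡ i′ × π′ ⟨$⟩ʳ j ≡ π ⟨$⟩ʳ i))
redirect π i i′ = π ∘ₚ transpose (π ⟨$⟩ʳ i) i′ , transpose-ˡ , cases
  where
  transpose-ˡ : transpose (π ⟨$⟩ʳ i) i′ ⟨$⟩ʳ (π ⟨$⟩ʳ i) ≡ i′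
  transpose-ˡ with π ⟨$⟩ʳ i ≟ π ⟨$⟩ʳ i
  ... | yes _ = refl
  ... | no ne = contradiction refl ne

  cases : ∀ j → transpose (π ⟨$⟩ʳ i) i′ ⟨$⟩ʳ (π ⟨$⟩ʳ j) ≡ π ⟨$⟩ʳ j ⊎
                (j ≡ i × transpose (π ⟨$⟩ʳ i) i′ ⟨$⟩ʳ (π ⟨$⟩ʳ j) ≡ i′) ⊎
                (π ⟨$⟩ʳ j ≡ i′ × transpose (π ⟨$⟩ʳ i) i′ ⟨$⟩ʳ (π ⟨$⟩ʳ j) ≡ π ⟨$⟩ʳ i)
  cases j with π ⟨$⟩ʳ j ≟ π ⟨$⟩ʳ i
  ... | yes eq = inj₂ (inj₁ (trans (sym (Perm.inverseˡ π))
                              (trans (cong (π ⟨$⟩ˡ_) eq) (Perm.inverseˡ π)) , refl))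
  ... | no _ with π ⟨$⟩ʳ j ≟ i′
  ...   | yes eq = inj₂ (inj₂ (eq , refl))
  ...   | no _   = inj₁ refl

module _ {n m} {G : Graph n} {x y : Fin n} {G′ : Graph m} (P : Pendant G x y G′) where
  open Pendant P

  -- If the guard standing on the pair leaves it while another one enters, both
  -- pass through the anchor, so after retraction they can exchange roles.
  redirected-step : ∀ {k} {c c′ : Fin k → Fin n} → Step G c c′ → ∀ {i i′} →
                    c i ≡ x ⊎ c i ≡ y → c′ i′ ≡ x ⊎ c′ i′ ≡ y →
                    ∃ λ (π : Permutation k k) → π ⟨$⟩ʳ i ≡ i′ ×
                      ∀ j → Legal G′ (retract (c j)) (retract (c′ (π ⟨$⟩ʳ j)))
  redirected-step {c = c} {c′} (π , legal) {i} {i′} i∈ i′∈ = π′ , π′i≡i′ , legal′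
    where
    π′ = proj₁ (redirect π i i′)
    π′i≡i′ = proj₁ (proj₂ (redirect π i i′))

    legal′ : ∀ j → Legal G′ (retract (c j)) (retract (c′ (π′ ⟨$⟩ʳ j)))
    legal′ j with proj₂ (proj₂ (redirect π i i′)) j
    ... | inj₁ eq rewrite eq = retract-legal (legal j)
    ... | inj₂ (inj₁ (refl , eq)) rewrite eq =
      inj₁ (trans (retract-pair i′∈) (sym (retract-pair i∈)))
    ... | inj₂ (inj₂ (πj≡i′ , eq)) rewrite eq =
      inj₁ (trans (retract-near i∈ (legal i))
        (sym (retract-near i′∈ (legal-sym G (subst (λ l → Legal G (c j) (c′ l)) πj≡i′ (legal j))))))

  module _ (y-leaf : ∀ {v} → Adj G y v → v ≡ x) where

    -- Only a guard on `y` or on its sole neighbour `x` can answer an attack at `y`, so one stands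
    -- there beforehand.
    pair-guarded : ∀ {k} (d : Defence G k) → let open Defence d in
                   ∀ s → ∃ λ i → guards s i ≡ x ⊎ guards s i ≡ y
    pair-guarded d s with Defence.respond d s y
    ... | s′ , (π , legal) , i , eq with legal (π ⟨$⟩ˡ i)
    ...   | stay-or-move rewrite Perm.inverseʳ π {i} | eq with stay-or-move
    ...     | inj₁ y≡ = π ⟨$⟩ˡ i , inj₂ (sym y≡)
    ...     | inj₂ vy = π ⟨$⟩ˡ i , inj₁ (y-leaf (Graph.sym G vy))

    -- A state also records a guard standing on the pair. This guard is left out after retraction:
    -- attacks outside the pair are answered by the others.
    retract-defence : ∀ {k} → Defence G (suc k) → Defence G′ k
    retract-defence {k} d = record
      { State   = State′
      ; start   = start , pair-guarded d start
      ; guards  = guards′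
      ; respond = respond′
      }
      where
      open Defence d
      State′ : Set
      State′ = Σ State λ s → ∃ λ i → guards s i ≡ x ⊎ guards s i ≡ y

      guards′ : State′ → Fin k → Fin m
      guards′ (s , i , _) j = retract (guards s (punchIn i j))

      respond′ : ∀ s r → ∃ λ s′ → Step G′ (guards′ s) (guards′ s′) × ∃ λ i → guards′ s′ i ≡ r
      respond′ (s , i , i∈) r with respond s (embed r)
      ... | s′ , step , j , eq with pair-guarded d s′
      ...   | i′ , i′∈ with redirected-step {c = guards s} {guards s′} step {i} {i′} i∈ i′∈
      ...     | π , refl , legal =
        (s′ , π ⟨$⟩ʳ i , i′∈) ,
        -- `π` carries the omitted label to the omitted label, so it restricts to the remaining
        -- ones.
        (remove i π , λ l → subst (λ z → Legal G′ _ (retract (guards s′ z)))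
                              (punchIn-permute π i l) (legal (punchIn i l))) ,
        punchOut i′≢j ,
        trans (cong (retract ∘ guards s′) (punchIn-punchOut i′≢j))
          (trans (cong retract eq) (retract-embed r))
        where
        -- The guard that answers stands outside the pair, so it is not the omitted one.
        i′≢j : π ⟨$⟩ʳ i ≢ j
        i′≢j refl = embed-outside (sym eq) i′∈

    defence-retract : ∀ {k} → Defence G k → ∃ λ k′ → k ≡ suc k′ × Defence G′ k′
    defence-retract {zero}  d with () ← proj₁ (pair-guarded d (Defence.start d))
    defence-retract {suc k} d = k , refl , retract-defence d

-- Defences and m-eternal domination

-- States are playable histories with a labelling of the position reached. The labelling is carried
-- along each guard move, so the permutation of labels is always the identity.
eternal⇒defence : ∀ {n} {G : Graph n} {D} → MEternalDominating G D → Defence G ∣ D ∣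
eternal⇒defence {G = G} {D} (σ , defends) = record
  { State   = State
  ; start   = [] , [] , subst (λ S → Enumeration S ∣ D ∣) (sym start) (enumerate D)
  ; guards  = guards
  ; respond = respond
  }
  where
  open Defends defends
  State : Set
  State = ∃ λ h → Playable G σ h × Enumeration (σ h) ∣ D ∣

  guards : State → Fin ∣ D ∣ → Fin _
  guards (_ , _ , e) i = proj₁ (Inverse.to e i)

  respond : ∀ s r → ∃ λ s′ → Step G (guards s) (guards s′) × ∃ λ i → guards s′ i ≡ r
  respond (h , p , e) r with r ∈? σ h
  -- The game has no attack on an occupied vertex; the state stays the same.
  ... | yes r∈ = (h , p , e) , (Perm.id , λ _ → inj₁ refl) ,
                 Inverse.from e (r , r∈) , cong proj₁ (Inverse.inverseˡ e refl)
  ... | no r∉ = (r ∷ h , r∉ ∷ p , e′) , (Perm.id , λ i → legal (Inverse.to e i)) ,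
                Inverse.from e′ (r , defended) , cong proj₁ (Inverse.inverseˡ e′ refl)
    where
    open Response (response r p r∉)
    open GuardMove guardMove
    e′ = ↔-trans e (⤖⇒↔ move)

-- The strategy replays the responses along the history and takes the set of guarded vertices;
-- injectivity makes its size `k`.
defence⇒eternal : ∀ {n k} {G : Graph n} → InjectiveDefence G k →
                  ∃ λ D → MEternalDominating G D × ∣ D ∣ ≡ k
defence⇒eternal {n} {k} {G} d = σ [] , (σ , defends) , enumeration-size (labels [])
  where
  open InjectiveDefence d
  after : List (Fin n) → State
  after []      = start
  after (r ∷ h) = proj₁ (respond (after h) r)

  guarded? : ∀ h v → Dec (∃ λ i → guards (after h) i ≡ v)
  guarded? h v = any? (λ i → guards (after h) i ≟ v)

  σ : Strategy G
  σ h = comprehension (guarded? h)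

  guards∈σ : ∀ h i → guards (after h) i ∈ σ h
  guards∈σ h i = ∈-comprehension⁺ (guarded? h) (i , refl)

  labels : ∀ h → Enumeration (σ h) k
  labels h = enumeration (guards (after h)) (guards-injective (after h))
    (guards∈σ h) (∈-comprehension⁻ (guarded? h))

  dominating : ∀ h → Dominating G (σ h)
  -- The guard that would answer an attack at `v` stands on a neighbour of `v`, since `v` itself is
  -- empty.
  dominating h v v∉ with respond (after h) v
  ... | s′ , (π , legal) , i , eq with legal (π ⟨$⟩ˡ i)
  ...   | stay-or-move rewrite Perm.inverseʳ π {i} | eq with stay-or-move
  ...     | inj₁ refl = contradiction (guards∈σ h _) v∉
  ...     | inj₂ uv   = guards (after h) (π ⟨$⟩ˡ i) , guards∈σ h _ , Graph.sym G uv

  response : ∀ h r → Response G (σ h) r (σ (r ∷ h))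
  response h r = record
    { sameSize  = trans (enumeration-size (labels (r ∷ h))) (sym (enumeration-size (labels h)))
    ; defended  = ∈-comprehension⁺ (guarded? (r ∷ h)) (proj₂ (proj₂ (respond (after h) r)))
    ; guardMove = record
      { move  = ↔⇒⤖ move
      ; legal = λ g → subst (λ v → Legal G v (proj₁ (Inverse.to move g)))
                        (cong proj₁ (Inverse.inverseˡ (labels h) {g} refl))
                        (proj₂ step (Inverse.from (labels h) g))
      }
    }
    where
    step = proj₁ (proj₂ (respond (after h) r))
    move = ↔-trans (↔-sym (labels h)) (↔-trans (proj₁ step) (labels (r ∷ h)))

  defends : Defends G (σ []) σ
  defends = record
    { start      = refl
    ; dominating = λ {h} _ → dominating h
    ; response   = λ {h} r _ _ → response h r
    }

-- Each guard stays inside its own clique, where it can reach any attacked vertex in one step.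
cliques⇒defence : ∀ {n k} {G : Graph n} → CliquePartition G k → InjectiveDefence G k
cliques⇒defence {n} {k} {G} C = record
  { defence = record
    { State   = Representatives
    ; start   = (λ i → proj₁ (nonempty i)) , λ i → proj₂ (nonempty i) refl
    ; guards  = proj₁
    ; respond = λ s r → (move s r , move-part s r) , (Perm.id , legal s r) , part r , moved s r
    }
  ; guards-injective = λ s eq → trans (sym (proj₂ s _)) (trans (cong part eq) (proj₂ s _))
  }
  where
  open CliquePartition C
  Representatives : Set
  Representatives = Σ (Fin k → Fin n) λ rep → ∀ i → part (rep i) ≡ i

  move : Representatives → Fin n → Fin k → Fin n
  move (rep , _) r i with i ≟ part r
  ... | yes _ = r
  ... | no  _ = rep i

  move-part : ∀ s r i → part (move s r i) ≡ i
  move-part (_ , rep-part) r i with i ≟ part r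
  ... | yes eq = sym eq
  ... | no  _  = rep-part i

  moved : ∀ s r → move s r (part r) ≡ r
  moved s r with part r ≟ part r
  ... | yes _ = refl
  ... | no ne = contradiction refl ne

  legal : ∀ s r i → Legal G (proj₁ s i) (move s r i)
  legal (rep , rep-part) r i with i ≟ part r
  ... | no _ = inj₁ refl
  ... | yes eq with r ≟ rep i
  ...   | yes r≡ = inj₁ r≡
  ...   | no r≢  = inj₂ (clique _ _ (trans (rep-part i) eq) (r≢ ∘ sym))

-- The upper bound

-- The additional guard only moves along the edge `ab`, and the `Bool` tells its end; the other
-- guards play on the remainder.
defence-edge : ∀ {n m k} {G : Graph n} {a b} {G′ : Graph m} → Removal G a b G′ → Adj G a b →
               InjectiveDefence G′ k → InjectiveDefence G (suc k)
defence-edge {n} {k = k} {G} {a} {b} R ab d = record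
  { defence = record
    { State = State × Bool
    ; start = start , true
    ; guards = guards⁺
    ; respond = λ (s , t) r → respond⁺ s t r (cover r)
    }
  ; guards-injective = injective
  }
  where
  open Removal R
  open InjectiveDefence d
  end : Bool → Fin n
  end t = if t then a else b

  end-legal : ∀ t t′ → Legal G (end t) (end t′)
  end-legal true  true  = inj₁ refl
  end-legal true  false = inj₂ ab
  end-legal false true  = inj₂ (Graph.sym G ab)
  end-legal false false = inj₁ refl

  embed≢end : ∀ t i → embed i ≢ end t
  embed≢end true  = embed≢a
  embed≢end false = embed≢b

  guards⁺ : State × Bool → Fin (suc k) → Fin n
  guards⁺ (s , t) zero    = end t
  guards⁺ (s , t) (suc i) = embed (guards s i)

  injective : ∀ s → Injective _≡_ _≡_ (guards⁺ s)
  injective (s , t) {zero}  {zero}  _  = refl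
  injective (s , t) {zero}  {suc _} eq = contradiction (sym eq) (embed≢end t _)
  injective (s , t) {suc _} {zero}  eq = contradiction eq (embed≢end t _)
  injective (s , t) {suc _} {suc _} eq = cong suc (guards-injective s (embed-injective eq))

  to-end : ∀ s t t′ → Step G (guards⁺ (s , t)) (guards⁺ (s , t′))
  to-end s t t′ = Perm.id , λ { zero → end-legal t t′ ; (suc _) → inj₁ refl }

  respond⁺ : ∀ s t r → r ≡ a ⊎ r ≡ b ⊎ (∃ λ i → embed i ≡ r) →
             ∃ λ s′ → Step G (guards⁺ (s , t)) (guards⁺ s′) × ∃ λ i → guards⁺ s′ i ≡ r
  respond⁺ s t r (inj₁ refl)        = (s , true)  , to-end s t true  , zero , refl
  respond⁺ s t r (inj₂ (inj₁ refl)) = (s , false) , to-end s t false , zero , refl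
  respond⁺ s t r (inj₂ (inj₂ (v , refl))) with respond s v
  ... | s′ , (π , legal) , i , eq =
    (s′ , t) ,
    (lift₀ π , λ { zero → inj₁ refl ; (suc j) → [ inj₁ ∘ cong embed , inj₂ ∘ adj⁺ ]′ (legal j) }) ,
    suc i , cong embed eq

-- With leaves a and b at x, the additional guard stands at x while the
-- defence of the rest leaves x empty, and on one of the leaves otherwise; so x
-- is always guarded.
defence-twins : ∀ {n m k} {G : Graph n} {a b} {G′ : Graph m} (R : Removal G a b G′) (x : Fin m) →
                let open Removal R in Adj G (embed x) a → Adj G (embed x) b →
                InjectiveDefence G′ k → InjectiveDefence G (suc k)
defence-twins {n} {k = k} {G} {a} {b} {G′} R x xa xb d = record
  { defence = record
    { State   = State × Bool
    ; start   = start , true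
    ; guards  = λ (s , t) → guards⁺ s t (occupied s)
    ; respond = λ (s , t) r → respond⁺ s t r (cover r)
    }
  ; guards-injective = λ (s , t) → injective s t (occupied s)
  }
  where
  open Removal R
  open InjectiveDefence d
  Occupied : State → Set
  Occupied s = ∃ λ i → guards s i ≡ x

  occupied : ∀ s → Dec (Occupied s)
  occupied s = any? (λ i → guards s i ≟ x)

  twin : Bool → Fin n
  twin t = if t then a else b

  twin-adj : ∀ t → Adj G (embed x) (twin t)
  twin-adj true  = xa
  twin-adj false = xb

  embed≢twin : ∀ t i → embed i ≢ twin t
  embed≢twin true  = embed≢a
  embed≢twin false = embed≢b

  guards⁺ : ∀ s → Bool → Dec (Occupied s) → Fin (suc k) → Fin n
  guards⁺ s t (yes _) zero    = twin t
  guards⁺ s t (no _)  zero    = embed x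
  guards⁺ s t _       (suc i) = embed (guards s i)

  injective : ∀ s t o → Injective _≡_ _≡_ (guards⁺ s t o)
  injective s t _       {zero}  {zero}  _  = refl
  injective s t (yes _) {zero}  {suc _} eq = contradiction (sym eq) (embed≢twin t _)
  injective s t (no ¬o) {zero}  {suc j} eq = contradiction (j , sym (embed-injective eq)) ¬o
  injective s t (yes _) {suc _} {zero}  eq = contradiction eq (embed≢twin t _)
  injective s t (no ¬o) {suc i} {zero}  eq = contradiction (i , embed-injective eq) ¬o
  injective s t (yes _) {suc _} {suc _} eq = cong suc (guards-injective s (embed-injective eq))
  injective s t (no _)  {suc _} {suc _} eq = cong suc (guards-injective s (embed-injective eq))

  extra-legal : ∀ s t s′ o o′ → Legal G (guards⁺ s t o zero) (guards⁺ s′ t o′ zero)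
  extra-legal s t s′ (yes _) (yes _) = inj₁ refl
  extra-legal s t s′ (yes _) (no _)  = inj₂ (Graph.sym G (twin-adj t))
  extra-legal s t s′ (no _)  (yes _) = inj₂ (twin-adj t)
  extra-legal s t s′ (no _)  (no _)  = inj₁ refl

  Answer : State → Bool → Fin n → Set
  Answer s t r = ∃ λ (s′ : State × Bool) → let s″ , t′ = s′ in
    Step G (guards⁺ s t (occupied s)) (guards⁺ s″ t′ (occupied s″)) ×
    ∃ λ i → guards⁺ s″ t′ (occupied s″) i ≡ r

  guards⁺-suc : ∀ {s t i} o → guards⁺ s t o (suc i) ≡ embed (guards s i)
  guards⁺-suc (yes _) = refl
  guards⁺-suc (no _)  = refl

  embed-legal : ∀ {s t s′ t′ i j} o o′ → Legal G′ (guards s i) (guards s′ j) →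
                Legal G (guards⁺ s t o (suc i)) (guards⁺ s′ t′ o′ (suc j))
  embed-legal {s} {t} {s′} {t′} {i} {j} o o′ l
    rewrite guards⁺-suc {s} {t} {i} o | guards⁺-suc {s′} {t′} {j} o′ =
    [ inj₁ ∘ cong embed , inj₂ ∘ adj⁺ ]′ l

  to-rest : ∀ s t v → Answer s t (embed v)
  to-rest s t v with respond s v
  ... | s′ , (π , legal) , i , eq =
    (s′ , t) ,
    (lift₀ π , λ { zero → extra-legal s t s′ (occupied s) (occupied s′)
                 ; (suc j) → embed-legal (occupied s) (occupied s′) (legal j) }) ,
    suc i , trans (guards⁺-suc (occupied s′)) (cong embed eq)

  -- The guard on `x` goes to the attacked leaf while the one on a leaf goes to `x`; the
  -- transposition records this exchange of roles.
  swap-legal : ∀ s t t′ {i} o → guards s i ≡ x → ∀ j →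
               Legal G (guards⁺ s t (yes o) j) (guards⁺ s t′ (yes o) (transpose zero (suc i) ⟨$⟩ʳ j))
  swap-legal s t t′ {i} o eq zero =
    inj₂ (subst (λ v → Adj G (twin t) (embed v)) (sym eq) (Graph.sym G (twin-adj t)))
  swap-legal s t t′ {i} o eq (suc j) with j ≟ i
  ... | yes refl = inj₂ (subst (λ v → Adj G (embed v) (twin t′)) (sym eq) (twin-adj t′))
  ... | no  _    = inj₁ refl

  to-twin : ∀ s t t′ → Answer s t (twin t′)
  to-twin s t t′ with occupied s in s-eq
  ... | yes o@(i , eq) = (s , t′) , answer
    where
    answer : Step G (guards⁺ s t (yes o)) (guards⁺ s t′ (occupied s)) ×
             ∃ λ i → guards⁺ s t′ (occupied s) i ≡ twin t′
    answer rewrite s-eq = (transpose zero (suc i) , swap-legal s t t′ o eq) , zero , refl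
  -- The additional guard stands on `x`. The rest responds as if `x` were attacked, which frees this
  -- guard for the leaf.
  ... | no ¬o with respond s x
  ...   | s′ , (π , legal) , i , eq = (s′ , t′) , answer
    where
    answer : Step G (guards⁺ s t (no ¬o)) (guards⁺ s′ t′ (occupied s′)) ×
             ∃ λ i → guards⁺ s′ t′ (occupied s′) i ≡ twin t′
    answer with occupied s′
    ... | no ¬o′ = contradiction (i , eq) ¬o′
    ... | yes o′ = (lift₀ π , λ { zero → inj₂ (twin-adj t′)
                                ; (suc j) → embed-legal {t = t} {t′ = t′} (no ¬o) (yes o′) (legal j) }) ,
                   zero , refl

  respond⁺ : ∀ s t r → r ≡ a ⊎ r ≡ b ⊎ (∃ λ i → embed i ≡ r) → Answer s t r
  respond⁺ s t r (inj₁ refl)              = to-twin s t true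
  respond⁺ s t r (inj₂ (inj₁ refl))       = to-twin s t false
  respond⁺ s t r (inj₂ (inj₂ (v , refl))) = to-rest s t v

-- Reducible graphs

module _ {n m} {G : Graph n} {a b : Fin n} {G′ : Graph m} (R : Removal G a b G′) where
  open Removal R

  pendant-edge : ∀ {u} → Adj G a u → u ≢ b → (∀ v → Adj G a v → v ≡ b ⊎ v ≡ u) →
                 (∀ v → Adj G b v → v ≡ a) → Pendant G a b G′
  pendant-edge {u} au u≢b nbr-a nbr-b with inside-remainder (adj⇒≢ G au ∘ sym) u≢b
  ... | t , refl = record
    { removed = R ; anchor = t ; nbr-a = nbr-a ; nbr-b = λ v bv → inj₁ (nbr-b v bv) }

  pendant-twins : ∀ {t} → (∀ v → Adj G a v → v ≡ embed t) → (∀ v → Adj G b v → v ≡ embed t) →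
                  Pendant G a b G′
  pendant-twins {t} nbr-a nbr-b = record
    { removed = R ; anchor = t
    ; nbr-a = λ v av → inj₂ (nbr-a v av) ; nbr-b = λ v bv → inj₂ (nbr-b v bv) }

  extend-cliques : ∀ {k} → Adj G a b → CliquePartition G′ k → CliquePartition G (suc k)
  extend-cliques {k} ab C = record
    { part     = λ v → part⁺ (cover v)
    ; nonempty = λ i → proj₁ (nonempty⁺ i) , λ { refl → proj₂ (nonempty⁺ i) }
    ; clique   = λ u v → clique⁺ (cover u) (cover v)
    }
    where
    open CliquePartition C
    Location : Fin n → Set
    Location v = v ≡ a ⊎ v ≡ b ⊎ ∃ λ i → embed i ≡ v

    part⁺ : ∀ {v} → Location v → Fin (suc k)
    part⁺ (inj₁ _)              = zero
    part⁺ (inj₂ (inj₁ _))       = zero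
    part⁺ (inj₂ (inj₂ (i , _))) = suc (part i)

    nonempty⁺ : ∀ i → ∃ λ v → part⁺ (cover v) ≡ i
    nonempty⁺ zero with cover a in eq
    ... | inj₁ _                = a , cong part⁺ eq
    ... | inj₂ (inj₁ _)         = a , cong part⁺ eq
    ... | inj₂ (inj₂ (i , i≡a)) = contradiction i≡a (embed≢a i)
    nonempty⁺ (suc j) with nonempty j
    ... | i , hit with cover (embed i) in eq
    ...   | inj₁ i≡a              = contradiction i≡a (embed≢a i)
    ...   | inj₂ (inj₁ i≡b)       = contradiction i≡b (embed≢b i)
    ...   | inj₂ (inj₂ (i′ , eq′)) = embed i ,
      trans (cong part⁺ eq) (cong suc (hit (embed-injective eq′)))

    clique⁺ : ∀ {u v} (p : Location u) (q : Location v) → part⁺ p ≡ part⁺ q → u ≢ v → Adj G u v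
    clique⁺ (inj₁ refl)        (inj₁ refl)        _ u≢v = contradiction refl u≢v
    clique⁺ (inj₁ refl)        (inj₂ (inj₁ refl)) _ _   = ab
    clique⁺ (inj₂ (inj₁ refl)) (inj₁ refl)        _ _   = Graph.sym G ab
    clique⁺ (inj₂ (inj₁ refl)) (inj₂ (inj₁ refl)) _ u≢v = contradiction refl u≢v
    clique⁺ (inj₂ (inj₂ (i , refl))) (inj₂ (inj₂ (j , refl))) eq u≢v =
      adj⁺ (clique i j (suc-injective eq) (u≢v ∘ cong embed))
    clique⁺ (inj₁ _) (inj₂ (inj₂ _)) ()
    clique⁺ (inj₂ (inj₁ _)) (inj₂ (inj₂ _)) ()
    clique⁺ (inj₂ (inj₂ _)) (inj₁ _) ()
    clique⁺ (inj₂ (inj₂ _)) (inj₂ (inj₁ _)) ()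

-- Fixes both parameters at `k` and survives undoing an R2 step. The bound ranges over defences with
-- shared vertices because retraction produces these.
Tight : ∀ {n} → Graph n → ℕ → Set₁
Tight G k = CliquePartition G k × (∀ j → Defence G j → k ≤ j)

-- A clique partition is itself a defence, so the one bound gives minimality of both numbers.
tight⇒γₘ^∞≡θ : ∀ {n k} {G : Graph n} → Tight G k → γₘ^∞≡θ G
tight⇒γₘ^∞≡θ {k = k} {G} (cliques , bound) = k ,
  ( defence⇒eternal (cliques⇒defence cliques)
  , λ { j (D , eternal , refl) → bound j (eternal⇒defence eternal) }) ,
  ( cliques
  , λ j C → bound j (InjectiveDefence.defence (cliques⇒defence C)))

tight-R2 : ∀ {n k} (G : Graph (2 + n)) (x y : Fin (2 + n)) (p : R2Pair G x y) →
           Tight (G ─ x ─ punchOut (adj⇒≢ G (R2Pair.adjacent p))) k → Tight G (suc k)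
tight-R2 {k = k} G x y p (cliques , bound) with degree≡2⁻ G (R2Pair.degree-x p) (R2Pair.adjacent p)
... | u , u≢y , xu , only = extend-cliques R adjacent cliques , bound⁺
  where
  open R2Pair p
  R = removal G x y (adj⇒≢ G adjacent)

  y-leaf : ∀ {v} → Adj G y v → v ≡ x
  y-leaf = degree≡1⁻ G leaf (Graph.sym G adjacent)

  bound⁺ : ∀ j → Defence G j → suc k ≤ j
  bound⁺ j d with defence-retract (pendant-edge R xu u≢y only (λ _ → y-leaf)) y-leaf d
  ... | j′ , refl , d′ = s≤s (bound j′ d′)

tight-≅ : ∀ {m n k} {G : Graph m} {H : Graph n} → G ≅ H → Tight H k → Tight G k
tight-≅ {k = k} {G} {H} iso (C , bound) = record
  { part     = λ v → part (to v)
  ; nonempty = λ i → let v , hit = nonempty i ; w , hit′ = surjective v in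
                     w , λ w≡ → hit (hit′ w≡)
  ; clique   = λ u v eq u≢v → Equivalence.from (adjacency u v) (clique _ _ eq (u≢v ∘ injective))
  } , λ j d → bound j (transport d)
  where
  open _≅_ iso
  open Bijection vertices using (to; injective; surjective)
  open CliquePartition C

  transport : ∀ {j} → Defence G j → Defence H j
  transport d = record
    { State   = State
    ; start   = start
    ; guards  = λ s i → to (guards s i)
    ; respond = λ s r →
        let v , hit = surjective r
            s′ , (π , legal) , i , eq = respond s v
        in s′ , (π , λ j → [ inj₁ ∘ cong to , inj₂ ∘ Equivalence.to (adjacency _ _) ]′ (legal j)) ,
           i , hit eq
    }
    where open Defence d

tight-K₁,₁ : Tight (K₁, 1) 1
tight-K₁,₁ = record
  { part     = λ _ → zero
  ; nonempty = λ { zero → zero , λ _ → refl }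
  ; clique   = clique
  } , bound
  where
  clique : ∀ u v → zero {0} ≡ zero → u ≢ v → Adj (K₁, 1) u v
  clique zero       zero       _ u≢v = contradiction refl u≢v
  clique zero       (suc zero) _ _   = _
  clique (suc zero) zero       _ _   = _
  clique (suc zero) (suc zero) _ u≢v = contradiction refl u≢v

  bound : ∀ j → Defence (K₁, 1) j → 1 ≤ j
  bound zero    d with _ , _ , () , _ ← Defence.respond d (Defence.start d) zero
  bound (suc j) d = s≤s z≤n

tight-K₁,₂ : Tight (K₁, 2) 2
tight-K₁,₂ = record
  { part     = part
  ; nonempty = λ { zero → zero , λ { refl → refl }
                 ; (suc zero) → suc (suc zero) , λ { refl → refl } }
  ; clique   = clique
  } , bound
  where
  part : Fin 3 → Fin 2
  part (suc (suc zero)) = suc zero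
  part _                = zero

  clique : ∀ u v → part u ≡ part v → u ≢ v → Adj (K₁, 2) u v
  clique zero             zero             _ u≢v = contradiction refl u≢v
  clique zero             (suc _)          _ _   = _
  clique (suc _)          zero             _ _   = _
  clique (suc zero)       (suc zero)       _ u≢v = contradiction refl u≢v
  clique (suc (suc zero)) (suc (suc zero)) _ u≢v = contradiction refl u≢v
  clique (suc zero)       (suc (suc zero)) () _
  clique (suc (suc zero)) (suc zero)       () _

  bound : ∀ j → Defence (K₁, 2) j → 2 ≤ j
  bound zero d with _ , _ , () , _ ← Defence.respond d (Defence.start d) zero
  -- A single guard would have to pass between the two leaves in one step.
  bound (suc zero) d with Defence.respond d (Defence.start d) (suc zero)
  ... | s , _ , i , at₁ with Defence.respond d s (suc (suc zero))
  ...   | s′ , (π , legal) , i′ , at₂ with legal i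
  ...     | l rewrite Fin1-irrelevant (π ⟨$⟩ʳ i) i′ | at₁ | at₂ with l
  ...       | inj₁ ()
  ...       | inj₂ ()
  bound (suc (suc j)) d = s≤s (s≤s z≤n)

tight-reduction : ∀ {G H : ∃ Graph} → Star R2 G H → (∃ λ k → Tight (proj₂ H) k) →
                  ∃ λ k → Tight (proj₂ G) k
tight-reduction ε tight = tight
tight-reduction (delete G x y p ◅ steps) tight with tight-reduction steps tight
... | k , tight′ = suc k , tight-R2 G x y p tight′

reducible⇒γₘ^∞≡θ : ∀ {n} {G : Graph n} →
                   (∃ λ r → (r ≡ 1 ⊎ r ≡ 2) × R2ReducesTo G (K₁, r)) → γₘ^∞≡θ G
reducible⇒γₘ^∞≡θ (r , r∈ , reduces) =
  tight⇒γₘ^∞≡θ (proj₂ (tight-reduction steps (_ , tight-≅ iso (proj₂ (star r∈)))))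
  where
  open R2ReducesTo reduces
  star : r ≡ 1 ⊎ r ≡ 2 → ∃ λ k → Tight (K₁, r) k
  star (inj₁ refl) = 1 , tight-K₁,₁
  star (inj₂ refl) = 2 , tight-K₁,₂

-- The fringe of a tree

spread : ∀ {n} {G : Graph n} → Connected G → (P : Fin n → Set) → ∀ {u} → P u →
         (∀ {v w} → P v → Adj G v w → P w) → ∀ v → P v
spread {G = G} connected P {u} Pu closed v = walk Pu (connected u v)
  where
  walk : ∀ {u} → P u → Star (Adj G) u v → P v
  walk Pu ε          = Pu
  walk Pu (uw ◅ wv)  = walk (closed Pu uw) wv

unique-lookup-injective : ∀ {A : Set} {xs : List A} → Unique xs → Injective _≡_ _≡_ (lookup xs)
unique-lookup-injective (_ ∷ _)   {zero}  {zero}  _  = refl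
unique-lookup-injective (px ∷ _)  {zero}  {suc j} eq = contradiction eq (All.lookup px (∈-lookup j))
unique-lookup-injective (px ∷ _)  {suc i} {zero}  eq = contradiction (sym eq) (All.lookup px (∈-lookup i))
unique-lookup-injective (_ ∷ pxs) {suc i} {suc j} eq = cong suc (unique-lookup-injective pxs eq)

_∈ˡ?_ : ∀ {n} (v : Fin n) xs → Dec (v ∈ˡ xs)
_∈ˡ?_ = member? _≟_

module _ {n} (G : Graph n) (s : Fin n) where

  -- Path x xs: the list x ∷ xs is a simple path read backwards, ending in s.
  data Path : Fin n → List (Fin n) → Set where
    root : Path s []
    step : ∀ {x y xs} → Adj G x y → y ∉ˡ (x ∷ xs) → Path x xs → Path y (x ∷ xs)

  root∈path : ∀ {x xs} → Path x xs → s ∈ˡ (x ∷ xs)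
  root∈path root         = here refl
  root∈path (step _ _ p) = there (root∈path p)

  path-unique : ∀ {x xs} → Path x xs → Unique (x ∷ xs)
  path-unique root          = [] ∷ []
  path-unique (step _ y∉ p) = ¬Any⇒All¬ _ y∉ ∷ path-unique p

  path-length : ∀ {x xs} → Path x xs → length (x ∷ xs) ≤ n
  path-length p = injective⇒≤ (unique-lookup-injective (path-unique p))

  -- Here `x ∷ ws` is the piece of the path from `x` back to `z`; the fields supply what closes it
  -- to a cycle.
  record Segment (x : Fin n) (xs : List (Fin n)) (z : Fin n) (ws : List (Fin n)) : Set where
    field
      linked : ∀ {v} → Adj G z v → Linked (Adj G) (x ∷ (ws ∷ʳ v))
      avoids : ∀ {v} → v ∉ˡ (x ∷ xs) → All (v ≢_) (x ∷ ws)
      unique : Unique (x ∷ ws)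

  cut : ∀ {x xs z} → z ∈ˡ (x ∷ xs) → List (Fin n)
  cut {xs = []}    _          = []
  cut {xs = _ ∷ _} (here _)   = []
  cut {xs = x ∷ _} (there z∈) = x ∷ cut z∈

  cut-segment : ∀ {x xs z} → Path x xs → (z∈ : z ∈ˡ (x ∷ xs)) → Segment x xs z (cut z∈)
  cut-segment root (here refl) = record
    { linked = λ zv → zv ∷ [-] ; avoids = λ v∉ → (v∉ ∘ here) ∷ [] ; unique = [] ∷ [] }
  cut-segment (step _ _ _) (here refl) = record
    { linked = λ zv → zv ∷ [-] ; avoids = λ v∉ → (v∉ ∘ here) ∷ [] ; unique = [] ∷ [] }
  cut-segment (step xy y∉ p) (there z∈) = record
    { linked = λ zv → Graph.sym G xy ∷ linked zv
    ; avoids = λ v∉ → (v∉ ∘ here) ∷ avoids (v∉ ∘ there)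
    ; unique = avoids y∉ ∷ unique
    }
    where open Segment (cut-segment p z∈)

  -- An edge from `y` to a path vertex before its predecessor `x` would close a cycle with the piece
  -- between them.
  no-chord : Acyclic G → ∀ {x y z xs} → Path y (x ∷ xs) → z ∈ˡ xs → ¬ Adj G y z
  -- Matching the shorter path against `step` shows that the `cut` is nonempty, so the cycle has at
  -- least three vertices.
  no-chord acyclic {x} {y} (step xy y∉ p@(step _ _ _)) z∈ yz =
    acyclic y (x ∷ cut (there {x = x} z∈)) record
    { distinct = avoids y∉ ∷ unique
    ; closed   = Graph.sym G xy ∷ linked (Graph.sym G yz)
    ; long     = s≤s (s≤s z≤n)
    }
    where open Segment (cut-segment p (there z∈))

  Extendable : Fin n → List (Fin n) → Set
  Extendable x xs = ∃ λ z → Adj G x z × z ∉ˡ (x ∷ xs)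

  extendable? : ∀ x xs → Dec (Extendable x xs)
  extendable? x xs = any? (λ z → adj? G x z ×-dec ¬? (z ∈ˡ? (x ∷ xs)))

  -- Excluding `s` ensures that such a leaf has a partner when all vertices but `s` are paired.
  LeafAt : Fin n → Fin n → Set
  LeafAt x z = z ≢ s × (∀ w → Adj G z w → w ≡ x)

  -- In the second case, u is the next vertex on the way from x to the root s.
  Around : Fin n → Fin n → Set
  Around x y = (∀ z → Adj G x z → LeafAt x z) ⊎
               (∃ λ u → Adj G x u × x ≢ s × u ≢ y × (∀ z → Adj G x z → z ≡ u ⊎ LeafAt x z))

  record Fringe : Set where
    field
      {x y}  : Fin n
      edge   : Adj G x y
      y-leaf : LeafAt x y
      around : Around x y

  -- The path can be prolonged by one vertex but not by two, and chords are excluded; so every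
  -- neighbour of `x` other than its predecessor is a leaf.
  path-end-fringe : Acyclic G → ∀ {x xs} → Path x xs → Extendable x xs →
                    (∀ z → Adj G x z → z ∉ˡ (x ∷ xs) → ¬ Extendable z (x ∷ xs)) → Fringe
  path-end-fringe acyclic {x} {xs} p (y , xy , y∉) maximal = record
    { edge   = xy
    ; y-leaf = leaf y xy y∉
    ; around = around p refl
    }
    where
    leaf : ∀ z → Adj G x z → z ∉ˡ (x ∷ _) → LeafAt x z
    leaf z xz z∉ = (λ { refl → z∉ (root∈path p) }) , only
      where
      only : ∀ w → Adj G z w → w ≡ x
      only w zw with w ∈ˡ? (z ∷ x ∷ _)
      ... | no w∉                  = contradiction (w , zw , w∉) (maximal z xz z∉)
      ... | yes (here refl)         = contradiction refl (adj⇒≢ G zw)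
      ... | yes (there (here refl)) = refl
      ... | yes (there (there w∈))  = contradiction zw (no-chord acyclic (step xz z∉ p) w∈)

    around : ∀ {ys} → Path x ys → ys ≡ xs → Around x y
    around root refl = inj₁ λ z xz → leaf z xz λ { (here refl) → adj⇒≢ G xz refl }
    around (step {u} ux x∉ q) refl = inj₂ (u , Graph.sym G ux ,
      (λ { refl → x∉ (root∈path q) }) , (λ { refl → y∉ (there (here refl)) }) , split)
      where
      split : ∀ z → Adj G x z → z ≡ u ⊎ LeafAt x z
      split z xz with z ∈ˡ? (x ∷ u ∷ _)
      ... | no z∉                   = inj₂ (leaf z xz z∉)
      ... | yes (here refl)         = contradiction refl (adj⇒≢ G xz)
      ... | yes (there (here refl)) = inj₁ refl
      ... | yes (there (there z∈))  = contradiction xz (no-chord acyclic p z∈)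

  -- Each unit of `fuel` pays for one more vertex. A simple path has at most `n` vertices, so the
  -- inequality rules out empty fuel.
  fringe-beyond : Acyclic G → ∀ fuel {x xs} → Path x xs → n < fuel + length (x ∷ xs) →
                  Extendable x xs → Fringe
  fringe-beyond acyclic zero p long _ = contradiction (path-length p) (<⇒≱ long)
  fringe-beyond acyclic (suc fuel) {x} {xs} p long ext
    with any? (λ z → (adj? G x z ×-dec ¬? (z ∈ˡ? (x ∷ xs))) ×-dec extendable? z (x ∷ xs))
  ... | yes (z , (xz , z∉) , ext′) =
    fringe-beyond acyclic fuel (step xz z∉ p)
      (subst (n <_) (sym (+-suc fuel (length (x ∷ xs)))) long) ext′
  ... | no none = path-end-fringe acyclic p ext (λ z xz z∉ ext′ → none (z , (xz , z∉) , ext′))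

  fringe : IsTree G → ∀ {v} → v ≢ s → Fringe
  fringe tree {v} v≢s = fringe-beyond (IsTree.acyclic tree) n root (m<m+n n (s≤s z≤n))
    (first (IsTree.connected tree s v))
    where
    first : Star (Adj G) s v → Extendable s []
    first ε        = contradiction refl v≢s
    first (sw ◅ _) = _ , sw , λ { (here refl) → adj⇒≢ G sw refl }

-- If `x` has a second leaf, it is deleted together with `y`; otherwise `x` and `y` are deleted.
-- Both leave a tree with `m` vertices.
fringe-defence : ∀ {m k s} (T : Graph (2 + m)) → IsTree T → Fringe T s →
                 ((T′ : Graph m) → IsTree T′ → InjectiveDefence T′ k) → InjectiveDefence T (suc k)
fringe-defence {m} {k} {s} T tree f smaller = cases around
  where
  open IsTree tree
  open Fringe f

  twins : ∀ {z} → z ≢ y → Adj T x z → LeafAt T s x z → InjectiveDefence T (suc k)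
  twins {z} z≢y xz (_ , z-leaf) = remove-twins (inside-remainder (adj⇒≢ T xz) (adj⇒≢ T edge))
    where
    R = removal T z y z≢y
    open Removal R
    remove-twins : (∃ λ i → embed i ≡ x) → InjectiveDefence T (suc k)
    remove-twins (i , eq) = defence-twins R i
      (subst (λ v → Adj T v z) (sym eq) xz) (subst (λ v → Adj T v y) (sym eq) edge)
      (smaller _ (tree-pendant
        (pendant-twins R (λ v zv → trans (z-leaf v zv) (sym eq))
                         (λ v yv → trans (proj₂ y-leaf v yv) (sym eq))) tree))

  R = removal T x y (adj⇒≢ T edge)

  -- Here `x` and `y` are the whole tree, and the remainder is the graph without vertices, which
  -- counts as a tree.
  last-edge : (∀ z → Adj T x z → z ≡ y) → IsTree (T ─ x ─ punchOut (adj⇒≢ T edge))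
  last-edge only = record
    { connected = λ i → ⊥-elim (Removal.embed-outside R refl (all-pair (Removal.embed R i)))
    ; acyclic   = acyclic-removal R acyclic
    }
    where
    closed : ∀ {v w} → v ≡ x ⊎ v ≡ y → Adj T v w → w ≡ x ⊎ w ≡ y
    closed (inj₁ refl) xw = inj₂ (only _ xw)
    closed (inj₂ refl) yw = inj₁ (proj₂ y-leaf _ yw)
    all-pair : ∀ v → v ≡ x ⊎ v ≡ y
    all-pair = spread {G = T} connected (λ v → v ≡ x ⊎ v ≡ y) (inj₁ refl) closed

  cases : Around T s x y → InjectiveDefence T (suc k)
  cases (inj₁ leaves) with any? (λ z → ¬? (z ≟ y) ×-dec adj? T x z)
  ... | yes (z , z≢y , xz) = twins z≢y xz (leaves z xz)
  ... | no none = defence-edge R edge (smaller _ (last-edge only))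
    where
    only : ∀ z → Adj T x z → z ≡ y
    only z xz = decidable-stable (z ≟ y) (λ z≢y → none (z , z≢y , xz))
  cases (inj₂ (u , xu , _ , u≢y , leaves))
    with any? (λ z → (¬? (z ≟ y) ×-dec ¬? (z ≟ u)) ×-dec adj? T x z)
  ... | yes (z , (z≢y , z≢u) , xz) =
    twins z≢y xz ([ (λ z≡u → contradiction z≡u z≢u) , id ]′ (leaves z xz))
  ... | no none = defence-edge R edge
    (smaller _ (tree-pendant (pendant-edge R xu u≢y only (proj₂ y-leaf)) tree))
    where
    only : ∀ z → Adj T x z → z ≡ y ⊎ z ≡ u
    only z xz with z ≟ y | z ≟ u
    ... | yes z≡y | _       = inj₁ z≡y
    ... | no _    | yes z≡u = inj₂ z≡u
    ... | no z≢y  | no z≢u  = contradiction (z , (z≢y , z≢u) , xz) none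

-- Every guard pays for two deleted vertices. The empty graph is a base case because a single edge
-- leads to it.
half-defence : ∀ n (T : Graph n) → IsTree T → InjectiveDefence T ⌈ n /2⌉
half-defence zero T _ = record
  { defence = record { State = ⊤ ; start = tt ; guards = λ _ () ; respond = λ _ () }
  ; guards-injective = λ { _ {()} }
  }
half-defence (suc zero) T _ = record
  { defence = record
    { State   = ⊤
    ; start   = tt
    ; guards  = λ _ i → i
    ; respond = λ _ r → tt , (Perm.id , λ _ → inj₁ refl) , r , refl
    }
  ; guards-injective = λ _ eq → eq
  }
half-defence (suc (suc m)) T tree =
  -- Any root serves here; `zero` is chosen, and `suc zero` is a second vertex.
  fringe-defence T tree (fringe T zero tree {suc zero} (λ ())) (half-defence m)

-- Clique coverings of trees

-- Parts may be empty, so `k` can stay fixed when the partition is restricted to a remainder.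
Cliques : ∀ {n k} → Graph n → (Fin n → Fin k) → Set
Cliques G part = ∀ u v → part u ≡ part v → u ≢ v → Adj G u v

Partner : ∀ {n k} → (Fin n → Fin k) → Fin n → Set
Partner part v = ∃ λ w → w ≢ v × part w ≡ part v

⌈n/2⌉*2≤1+n : ∀ n → ⌈ n /2⌉ * 2 ≤ suc n
⌈n/2⌉*2≤1+n zero          = z≤n
⌈n/2⌉*2≤1+n (suc zero)    = s≤s (s≤s z≤n)
⌈n/2⌉*2≤1+n (suc (suc n)) = s≤s (s≤s (⌈n/2⌉*2≤1+n n))

module _ {n k} {G : Graph n} (acyclic : Acyclic G) (part : Fin n → Fin k)
         (cliques : Cliques G part) where

  -- Three vertices of one part would form a cycle; parts thus have at most two vertices and
  -- describe a matching.
  no-triangle : ∀ {u v w} → u ≢ v → v ≢ w → w ≢ u → part u ≡ part v → part v ≡ part w → ⊥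
  no-triangle {u} {v} {w} u≢v v≢w w≢u uv vw = acyclic u (v ∷ w ∷ []) record
    { distinct = (u≢v ∷ (w≢u ∘ sym) ∷ []) ∷ (v≢w ∷ []) ∷ [] ∷ []
    ; closed   = cliques u v uv u≢v ∷ cliques v w vw v≢w ∷ cliques w u (sym (trans uv vw)) w≢u ∷ [-]
    ; long     = s≤s (s≤s z≤n)
    }

  -- Each part has two slots; a vertex takes the second one when an earlier
  -- vertex of its part exists. If s and t are alone in their parts, the second
  -- slots of these two parts remain free.
  two-singletons : ∀ {s t} → s ≢ t → ¬ Partner part s → ¬ Partner part t → 2 + n ≤ k * 2
  two-singletons {s} {t} s≢t alone-s alone-t = injective⇒≤ (λ {i} {j} → slot-injective i j)
    where
    Earlier : Fin n → Set
    Earlier v = ∃ λ w → w Fin.< v × part w ≡ part v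

    earlier? : ∀ v → Dec (Earlier v)
    earlier? v = any? (λ w → (w <? v) ×-dec (part w ≟ part v))

    half : ∀ {v} → Dec (Earlier v) → Fin 2
    half (yes _) = suc zero
    half (no _)  = zero

    half⁺ : ∀ {v} (d : Dec (Earlier v)) → Earlier v → half d ≡ suc zero
    half⁺ (yes _) _ = refl
    half⁺ (no ¬e) e = contradiction e ¬e

    half⁻ : ∀ {v} (d : Dec (Earlier v)) → half d ≡ suc zero → Earlier v
    half⁻ (yes e) _ = e

    slot : Fin (2 + n) → Fin (k * 2)
    slot zero          = combine (part s) (suc zero)
    slot (suc zero)    = combine (part t) (suc zero)
    slot (suc (suc v)) = combine (part v) (half (earlier? v))

    alone : ∀ {s v} → ¬ Partner part s → part v ≡ part s → v ≡ s
    alone {s} {v} alone-s eq = decidable-stable (v ≟ s) (λ v≢s → alone-s (v , v≢s , eq))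

    free : ∀ {s v} → ¬ Partner part s →
           combine (part s) (suc zero) ≢ combine (part v) (half (earlier? v))
    free {s} {v} alone-s eq
      with combine-injective (part s) (suc zero) (part v) (half (earlier? v)) eq
    ... | ps≡pv , second with half⁻ (earlier? v) (sym second)
    ...   | w , w<v , pw≡pv = <⇒≢ w<v
      (trans (alone alone-s (trans pw≡pv (sym ps≡pv))) (sym (alone alone-s (sym ps≡pv))))

    -- The later vertex takes the second slot. If the earlier one took it too, the part would
    -- contain a third vertex.
    ordered : ∀ {u v} → u Fin.< v → part u ≡ part v → half (earlier? u) ≢ half (earlier? v)
    ordered {u} {v} u<v eq same
      with half⁻ (earlier? u) (trans same (half⁺ (earlier? v) (u , u<v , eq)))
    ... | w , w<u , pw≡pu = no-triangle (<⇒≢ w<u) (<⇒≢ u<v) (<⇒≢ (<-trans w<u u<v) ∘ sym) pw≡pu eq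

    slot-injective : ∀ i j → slot i ≡ slot j → i ≡ j
    slot-injective zero zero _ = refl
    slot-injective (suc zero) (suc zero) _ = refl
    slot-injective zero (suc zero) eq = contradiction
      (sym (alone alone-s (sym
        (proj₁ (combine-injective (part s) (suc zero) (part t) (suc zero) eq))))) s≢t
    slot-injective (suc zero) zero eq = contradiction
      (sym (alone alone-s
        (proj₁ (combine-injective (part t) (suc zero) (part s) (suc zero) eq)))) s≢t
    slot-injective zero (suc (suc v)) eq = contradiction eq (free alone-s)
    slot-injective (suc zero) (suc (suc v)) eq = contradiction eq (free alone-t)
    slot-injective (suc (suc v)) zero eq = contradiction (sym eq) (free alone-s)
    slot-injective (suc (suc v)) (suc zero) eq = contradiction (sym eq) (free alone-t)
    slot-injective (suc (suc u)) (suc (suc v)) eq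
      with combine-injective (part u) (half (earlier? u)) (part v) (half (earlier? v)) eq | <-cmp u v
    ... | _ , _          | tri≈ _ refl _ = refl
    ... | pu≡pv , same   | tri< u<v _ _ = contradiction same (ordered u<v pu≡pv)
    ... | pu≡pv , same   | tri> _ _ v<u = contradiction (sym same) (ordered v<u (sym pu≡pv))

  partner? : ∀ v → Dec (Partner part v)
  partner? v = any? (λ w → ¬? (w ≟ v) ×-dec (part w ≟ part v))

  -- Two unpaired vertices would give `2 + n ≤ k * 2 ≤ ⌈ n /2⌉ * 2 ≤ 1 + n`.
  unpaired-vertex : Fin n → k ≤ ⌈ n /2⌉ → ∃ λ s → ∀ v → v ≢ s → Partner part v
  unpaired-vertex v₀ k≤ with any? (λ v → ¬? (partner? v))
  -- When all vertices are paired, any vertex may be named; `v₀` is the default.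
  ... | no none = v₀ , λ v _ → decidable-stable (partner? v) (λ alone → none (v , alone))
  ... | yes (s , alone-s) = s , λ v v≢s →
    decidable-stable (partner? v)
      (λ alone-v → <⇒≱ (two-singletons v≢s alone-v alone-s)
                    (≤-trans (*-monoˡ-≤ 2 k≤) (⌈n/2⌉*2≤1+n n)))

-- Reducing a paired tree to a star

star-≅ : ∀ {n r} {G : Graph n} → Connected G → ∀ {c} (ℓ : Fin r → Fin n) → Injective _≡_ _≡_ ℓ →
         (∀ i → Adj G c (ℓ i)) → (∀ v → Adj G c v → ∃ λ i → ℓ i ≡ v) →
         (∀ i v → Adj G (ℓ i) v → v ≡ c) → G ≅ (K₁, r)
star-≅ {n} {r} {G} connected {c} ℓ ℓ-injective cℓ nbr-c nbr-ℓ = record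
  { vertices  = ↔⇒⤖ (mk↔ₛ′ (proj₁ ∘ onto) e (λ i → e-injective _ i (proj₂ (onto (e i))))
                             (proj₂ ∘ onto))
  ; adjacency = λ u v → mk⇔
      (λ uv → adjacent⁺ _ _ (subst₂ (Adj G) (sym (proj₂ (onto u))) (sym (proj₂ (onto v))) uv))
      (λ ij → subst₂ (Adj G) (proj₂ (onto u)) (proj₂ (onto v)) (adjacent⁻ _ _ ij))
  }
  where
  e : Fin (suc r) → Fin n
  e zero    = c
  e (suc i) = ℓ i

  e-injective : ∀ i j → e i ≡ e j → i ≡ j
  e-injective zero    zero    _  = refl
  e-injective zero    (suc j) eq = contradiction eq (adj⇒≢ G (cℓ j))
  e-injective (suc i) zero    eq = contradiction (sym eq) (adj⇒≢ G (cℓ i))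
  e-injective (suc i) (suc j) eq = cong suc (ℓ-injective eq)

  onto : ∀ v → ∃ λ i → e i ≡ v
  -- The centre and its leaves are closed under adjacency, so by connectedness they are all the
  -- vertices.
  onto = spread {G = G} connected (λ v → ∃ λ i → e i ≡ v) (zero , refl) closed
    where
    closed : ∀ {v w} → (∃ λ i → e i ≡ v) → Adj G v w → ∃ λ i → e i ≡ w
    closed (zero  , refl) cw = let i , eq = nbr-c _ cw in suc i , eq
    closed (suc i , refl) vw = zero , sym (nbr-ℓ i _ vw)

  adjacent⁺ : ∀ i j → Adj G (e i) (e j) → StarAdj r i j
  adjacent⁺ zero    zero    a = contradiction refl (adj⇒≢ G a)
  adjacent⁺ zero    (suc _) _ = tt
  adjacent⁺ (suc _) zero    _ = tt
  adjacent⁺ (suc i) (suc j) a = adj⇒≢ G (cℓ j) (sym (nbr-ℓ i _ a))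

  adjacent⁻ : ∀ i j → StarAdj r i j → Adj G (e i) (e j)
  adjacent⁻ zero    (suc j) _ = cℓ j
  adjacent⁻ (suc i) zero    _ = Graph.sym G (cℓ i)

Reducible : ∀ {n} → Graph n → Set₁
Reducible G = ∃ λ r → (r ≡ 1 ⊎ r ≡ 2) × R2ReducesTo G (K₁, r)

reducible-step : ∀ {n} (G : Graph (2 + n)) {x y} (p : R2Pair G x y) →
                 Reducible (G ─ x ─ punchOut (adj⇒≢ G (R2Pair.adjacent p))) → Reducible G
reducible-step G {x} {y} p (r , r∈ , reduces) = r , r∈ , record
  { final = final ; steps = delete G x y p ◅ steps ; iso = iso }
  where open R2ReducesTo reduces

-- All vertices but s are matched with a neighbour. The mate of a leaf at x can
-- only be x, so the end of the tree at x consists of one leaf.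
fringe-reducible :
  ∀ {m k s} (T : Graph (2 + m)) → IsTree T → Fringe T s →
  (part : Fin (2 + m) → Fin k) → Cliques T part → (∀ v → v ≢ s → Partner part v) →
  ((T′ : Graph m) → IsTree T′ → ∀ {s′ v′} → v′ ≢ s′ →
   (part′ : Fin m → Fin k) → Cliques T′ part′ → (∀ v → v ≢ s′ → Partner part′ v) → Reducible T′) →
  Reducible T
fringe-reducible {m} {k} {s} T tree f part cliques paired smaller = cases around
  where
  open IsTree tree
  open Fringe f

  mate : ∀ {z} → LeafAt T s x z → part z ≡ part x
  mate {z} (z≢s , only) with paired z z≢s
  ... | w , w≢z , eq with only w (cliques z w (sym eq) (w≢z ∘ sym))
  ...   | refl = sym eq

  -- Two leaves at `x` would both share the part of `x` and hence be adjacent to each other.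
  only-leaf : ∀ {z} → LeafAt T s x z → z ≡ y
  only-leaf {z} lz@(_ , only) = decidable-stable (z ≟ y) λ z≢y →
    adj⇒≢ T edge (sym (only y (cliques z y (trans (mate lz) (sym (mate y-leaf))) z≢y)))

  cases : Around T s x y → Reducible T
  cases (inj₁ leaves) = 1 , inj₁ refl , record
    { final = T ; steps = ε
    ; iso = star-≅ connected (λ _ → y) (λ _ → Fin1-irrelevant _ _) (λ _ → edge)
              (λ v xv → zero , sym (only-leaf (leaves v xv))) (λ _ → proj₂ y-leaf)
    }
  cases (inj₂ (u , xu , x≢s , u≢y , leaves)) with any? (λ w → adj? T u w ×-dec ¬? (w ≟ x))
  -- `u` has no neighbour but `x`, so the tree is the path `u`, `x`, `y`.
  ... | no none = 2 , inj₂ refl , record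
    { final = T ; steps = ε
    ; iso = star-≅ connected (pair u y) (pair-injective u≢y)
              (λ { zero → xu ; (suc zero) → edge }) ends-all ends-leaf
    }
    where
    ends-all : ∀ v → Adj T x v → ∃ λ i → pair u y i ≡ v
    ends-all v xv = [ (λ { refl → zero , refl }) , (λ lv → suc zero , sym (only-leaf lv)) ]′ (leaves v xv)

    ends-leaf : ∀ i v → Adj T (pair u y i) v → v ≡ x
    ends-leaf zero       v uv = decidable-stable (v ≟ x) (λ v≢x → none (v , uv , v≢x))
    ends-leaf (suc zero) v yv = proj₂ y-leaf v yv
  -- The second neighbour `w` shows that `u` is not a leaf, so `y` is the only leaf at `x` and R2
  -- applies.
  ... | yes (w , uw , w≢x) = reducible-step T xy-pair
    (rest (inside-remainder (x≢s ∘ sym) (proj₁ y-leaf ∘ sym))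
          (inside-remainder (adj⇒≢ T xu ∘ sym) u≢y)
          (inside-remainder w≢x λ { refl → adj⇒≢ T xu (sym (proj₂ y-leaf u (Graph.sym T uw))) }))
    where
    nbrs : ∀ z → Adj T x z → z ≡ y ⊎ z ≡ u
    nbrs z xz = [ inj₂ , (λ lz → inj₁ (only-leaf lz)) ]′ (leaves z xz)

    y-degree : degree T y ≡ 1
    y-degree = degree≡1⁺ T (Graph.sym T edge) (proj₂ y-leaf)

    xy-pair : R2Pair T x y
    xy-pair = record
      { stem     = y , edge , y-degree
      ; degree-x = degree≡2⁺ T (u≢y ∘ sym) edge xu nbrs
      ; adjacent = edge
      ; leaf     = y-degree
      ; onlyLeaf = λ z xz leaf-z →
          [ id , (λ { refl → contradiction (degree≡1⁻ T leaf-z (Graph.sym T xu) uw) w≢x }) ]′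
            (nbrs z xz)
      }

    R = removal T x y (adj⇒≢ T edge)
    open Removal R

    -- A further member of the part of `x` and `y` would be a second neighbour of `y`. So the
    -- remaining vertices keep their partners.
    outside-part : ∀ {v} i → v ≡ x ⊎ v ≡ y → part v ≢ part (embed i)
    outside-part i v∈ eq = embed≢a i (proj₂ y-leaf _
      (cliques y (embed i) (trans (part-y v∈) eq) (embed≢b i ∘ sym)))
      where
      part-y : ∀ {v} → v ≡ x ⊎ v ≡ y → part y ≡ part v
      part-y (inj₁ refl) = mate y-leaf
      part-y (inj₂ refl) = refl

    rest : (∃ λ i → embed i ≡ s) → (∃ λ i → embed i ≡ u) → (∃ λ i → embed i ≡ w) →
           Reducible (T ─ x ─ punchOut (adj⇒≢ T edge))
    rest (s′ , s≡) (u′ , u≡) (w′ , w≡) =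
      smaller _ (tree-pendant (pendant-edge R xu u≢y nbrs (proj₂ y-leaf)) tree) (proj₂ other)
        (part ∘ embed) (λ i j eq i≢j → cliques _ _ eq (i≢j ∘ embed-injective)) paired′
      where
      -- The recursion needs a vertex besides `s′`; the adjacent vertices `u` and `w` cannot both be
      -- `s`.
      other : ∃ λ v′ → v′ ≢ s′
      other with u′ ≟ s′
      ... | no u′≢s′ = u′ , u′≢s′
      ... | yes u′≡s′ = w′ , λ w′≡s′ → adj⇒≢ T uw
        (trans (sym u≡) (trans (cong embed (trans u′≡s′ (sym w′≡s′))) w≡))

      paired′ : ∀ i → i ≢ s′ → Partner (part ∘ embed) i
      paired′ i i≢s′ with paired (embed i) (λ eq → i≢s′ (embed-injective (trans eq (sym s≡))))
      ... | v , v≢ , eq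
        with inside-remainder {v} (λ v≡x → outside-part i (inj₁ v≡x) eq)
                                  (λ v≡y → outside-part i (inj₂ v≡y) eq)
      ...   | j , refl = j , v≢ ∘ cong embed , eq

-- The vertex `v` distinct from `s` carries along that at least two vertices are left.
paired-reducible :
  ∀ n {k} (T : Graph n) → IsTree T → ∀ {s v} → v ≢ s →
  (part : Fin n → Fin k) → Cliques T part → (∀ v → v ≢ s → Partner part v) → Reducible T
paired-reducible (suc zero) T tree v≢s = contradiction (Fin1-irrelevant _ _) v≢s
paired-reducible (suc (suc m)) T tree {s} v≢s part cliques paired =
  fringe-reducible T tree (fringe T s tree v≢s) part cliques paired (paired-reducible m)

-- As a minimum number of guards, `k` is at most `⌈ n /2⌉`; as a number of cliques, it then leaves
-- at most one vertex unpaired.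
γₘ^∞≡θ⇒reducible : ∀ {n} (T : Graph n) → IsTree T → 2 ≤ n → γₘ^∞≡θ T → Reducible T
γₘ^∞≡θ⇒reducible {suc (suc m)} T tree _ (k , (_ , γ-minimal) , (C , _)) =
  paired-reducible (2 + m) T tree (proj₂ (other s)) part clique paired
  where
  open CliquePartition C
  few : k ≤ ⌈ 2 + m /2⌉
  few = γ-minimal ⌈ 2 + m /2⌉ (defence⇒eternal (half-defence (2 + m) T tree))

  unpaired = unpaired-vertex (IsTree.acyclic tree) part clique zero few
  s = proj₁ unpaired
  paired = proj₂ unpaired

  other : ∀ s → ∃ λ (v : Fin (2 + m)) → v ≢ s
  other zero    = suc zero , λ ()
  other (suc _) = zero , λ ()
γₘ^∞≡θ⇒reducible {suc zero} _ _ (s≤s ())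

theorem5p2 : ∀ {n : ℕ} (T : Graph n) → IsTree T → 2 ≤ n →
    γₘ^∞≡θ T ⇔ (∃ λ (r : ℕ) → (r ≡ 1 ⊎ r ≡ 2) × R2ReducesTo T (K₁, r))
theorem5p2 T tree 2≤n = mk⇔ (γₘ^∞≡θ⇒reducible T tree 2≤n) reducible⇒γₘ^∞≡θ
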